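{- Let $n\ge 2$ be an integer and let $\mathcal{Y}_{2n+1}$ be the graph obtained from the complete graph $K_{2n+1}$ by adding a new vertex $v_0$ adjacent to exactly three vertices of $K_{2n+1}$. Then $\mathcal{Y}_{2n+1}$ is PMH but not 2FH. Moreover, the vertex $v_0$ is 3-malleable.
   Context: A $2$-factor of a graph is a $2$-regular spanning subgraph (not necessarily connected), a Hamiltonian cycle is a connected $2$-factor, and a perfect matching is the edge set of a $1$-regular spanning subgraph. A Hamiltonian cycle $H$ extends a perfect matching $M$ if $M\subseteq E(H)$. A graph is 2FH (2-factor Hamiltonian) if it has a Hamiltonian cycle and each of its $2$-factors is a Hamiltonian cycle. A graph admitting a perfect matching is PMH if every one of its perfect matchings can be extended to a Hamiltonian cycle. For a vertex $v$, $\partial v$ denotes the set of edges incident to $v$. If $G$ admits a perfect matching and $v$ is a vertex of degree $t\ge 2$, then $v$ is $t$-malleable if for every perfect matching $M$ of $G$ there exist Hamiltonian cycles $H_1,\dots,H_{t-1}$ of $G$, all extending $M$, such that $\partial v - M\subset \bigcup_{i=1}^{t-1}E(H_i)$. -}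

module Defs where

open import Data.Bool using (Bool; false; not; T)
open import Data.Fin using (Fin; zero; suc; _≟_)
open import Data.Fin.Subset using (Subset; ∣_∣)
open import Data.Nat using (ℕ; suc; _+_; _*_; _∸_; _≤_)
open import Data.Product using (_×_; ∃)
open import Data.Vec using (lookup; tabulate)
open import Relation.Binary.Construct.Closure.ReflexiveTransitive using (Star)
open import Relation.Binary.PropositionalEquality using (_≡_; refl; sym)
open import Relation.Nullary using (¬_; does; yes; no; contradiction)

-- Finite simple graphs with vertex set Fin m.  Adjacency is Bool-valued, so
-- that edge sets of a finite graph are decidable, as they are classically.

record Graph (m : ℕ) : Set where
  field
    adj       : Fin m → Fin m → Bool
    symmetric : ∀ u v → adj u v ≡ adj v u
    loopless  : ∀ v → adj v v ≡ false

open Graph public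

Adj : ∀ {m} → Graph m → Fin m → Fin m → Set
Adj G u v = T (adj G u v)

degree : ∀ {m} → Graph m → Fin m → ℕ
degree G v = ∣ tabulate (adj G v) ∣

-- Containment of edge sets.  As both graphs have vertex set Fin m, F ⊆ᴱ G
-- also says that F is a spanning subgraph of G.

infix 4 _⊆ᴱ_

_⊆ᴱ_ : ∀ {m} → Graph m → Graph m → Set
F ⊆ᴱ G = ∀ u v → Adj F u v → Adj G u v

Regular : ∀ {m} → ℕ → Graph m → Set
Regular k G = ∀ v → degree G v ≡ k

Connected : ∀ {m} → Graph m → Set
Connected G = ∀ u v → Star (Adj G) u v

-- In the following, the first graph is the ambient one.

TwoFactor : ∀ {m} → Graph m → Graph m → Set
TwoFactor G F = F ⊆ᴱ G × Regular 2 F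

HamiltonianCycle : ∀ {m} → Graph m → Graph m → Set
HamiltonianCycle G H = TwoFactor G H × Connected H

-- A perfect matching, being the edge set of a 1-regular spanning subgraph, is
-- represented by that subgraph.

PerfectMatching : ∀ {m} → Graph m → Graph m → Set
PerfectMatching G M = M ⊆ᴱ G × Regular 1 M

Extends : ∀ {m} → Graph m → Graph m → Graph m → Set
Extends G H M = HamiltonianCycle G H × M ⊆ᴱ H

2FH : ∀ {m} → Graph m → Set
2FH G = ∃ (HamiltonianCycle G) × (∀ F → TwoFactor G F → HamiltonianCycle G F)

PMH : ∀ {m} → Graph m → Set
PMH {m} G =
  ∃ (PerfectMatching G) ×
  (∀ M → PerfectMatching G M → ∃ λ (H : Graph m) → Extends G H M)

-- The edges in ∂v are named by their end other than v.

Malleable : ∀ {m} → Graph m → ℕ → Fin m → Set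
Malleable {m} G t v =
  ∃ (PerfectMatching G) ×
  degree G v ≡ t ×
  2 ≤ t ×
  (∀ M → PerfectMatching G M →
    ∃ λ (H : Fin (t ∸ 1) → Graph m) →
      (∀ i → Extends G (H i) M) ×
      (∀ u → Adj G v u → ¬ Adj M v u → ∃ λ i → Adj (H i) v u))

complete : ∀ m → Graph m
complete m = record
  { adj       = λ u v → not (does (u ≟ v))
  ; symmetric = symm
  ; loopless  = irr
  }
  where
  symm : ∀ u v → not (does (u ≟ v)) ≡ not (does (v ≟ u))
  symm u v with u ≟ v | v ≟ u
  ... | yes _ | yes _ = refl
  ... | no _  | no _  = refl
  ... | yes p | no ¬q = contradiction (sym p) ¬q
  ... | no ¬p | yes q = contradiction (sym q) ¬p

  irr : ∀ v → not (does (v ≟ v)) ≡ false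
  irr v with v ≟ v
  ... | yes _ = refl
  ... | no ¬p = contradiction refl ¬p

-- The new vertex is zero, its neighbourhood is S, and each old vertex i
-- becomes suc i.

addVertex : ∀ {m} → Graph m → Subset m → Graph (suc m)
addVertex {m} G S = record { adj = a ; symmetric = symm ; loopless = irr }
  where
  a : Fin (suc m) → Fin (suc m) → Bool
  a zero    zero    = false
  a zero    (suc j) = lookup S j
  a (suc i) zero    = lookup S i
  a (suc i) (suc j) = adj G i j

  symm : ∀ u v → a u v ≡ a v u
  symm zero    zero    = refl
  symm zero    (suc j) = refl
  symm (suc i) zero    = refl
  symm (suc i) (suc j) = symmetric G i j

  irr : ∀ v → a v v ≡ false
  irr zero    = refl
  irr (suc i) = loopless G i

𝒴 : ∀ n → Subset (1 + 2 * n) → Graph (suc (1 + 2 * n))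
𝒴 n S = addVertex (complete (1 + 2 * n)) S

{-# OPTIONS --safe #-}

-- A permutation π without fixed points spans a graph joining u to π u, which
-- is 1-regular if π is an involution, 2-regular if π ∘ π has no fixed points,
-- and contained in 𝒴 as soon as both edges at the new vertex v₀ are.  So only
-- permutations have to be found.
-- A perfect matching M matches v₀ with some a; let b be another neighbour of
-- v₀ and b′ its partner in M.  Every cyclic sequence of the oriented edges of
-- M in which (b′ , b) is followed by (v₀ , a) is a Hamiltonian cycle extending
-- M and using v₀b.
-- The triangle on v₀ and two of its neighbours together with a cycle through
-- the remaining 2n − 1 ≥ 3 vertices is a disconnected 2-factor.

module Submission where

open import Data.Bool using (Bool; true; false; T; _∨_)
open import Data.Bool.Properties using (T-∨; T-irrelevant; ∨-comm)
open import Data.Empty using (⊥)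
open import Data.Fin using
  (Fin; zero; suc; _≟_; _<_; _<?_; fromℕ; inject₁; toℕ; punchIn; punchOut; _↑ˡ_)
open import Data.Fin.Induction using (<-weakInduction)
open import Data.Fin.Patterns using (0F; 1F; 2F)
open import Data.Fin.Permutation using
  (Permutation′; _⟨$⟩ʳ_; _⟨$⟩ˡ_; inverseˡ; inverseʳ; insert; ↔⇒≡)
open import Data.Fin.Properties using
  (<-asym; <-cmp; suc-injective; toℕ-inject₁; +↔⊎; *↔×; injective⇒≤; punchInᵢ≢i;
   punchIn-punchOut; punchOut-injective)
open import Data.Fin.Relation.Unary.Top using (view; view-fromℕ; view-inject₁; ‵fromℕ; ‵inject₁)
open import Data.Fin.Subset using (Subset; ∣_∣)
open import Data.Nat using (ℕ; zero; suc; _+_; _*_; _≤_; z≤n; s≤s)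
import Data.Nat.Properties as ℕ
open import Data.Nat.Properties using (*-comm; *-monoʳ-≤; m≤n⇒∃[o]m+o≡n; n<1+n; m<n⇒m<1+n; <⇒≢)
open import Data.Product using (_×_; _,_; ∃; proj₁; proj₂)
open import Data.Sum using (_⊎_; inj₁; inj₂; [_,_]′)
open import Data.Sum.Function.Propositional using (_⊎-↔_)
open import Data.Sum.Properties using (inj₁-injective; inj₂-injective)
open import Data.Vec using (_∷_; lookup; tabulate)
open import Data.Vec.Properties using (lookup∘tabulate; tabulate∘lookup)
open import Function using (_∘_; Injective; Injection; _↔_; Inverse; mk↔ₛ′; mk⤖; Equivalence)
open import Function.Construct.Composition using (_↔-∘_)
open import Function.Construct.Identity using (↔-id)
open import Function.Construct.Symmetry using (↔-sym)
open import Function.Properties.Bijection using (⤖⇒↔)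
open import Function.Properties.Inverse using (↔⇒↣)
open import Relation.Binary.Construct.Closure.ReflexiveTransitive using
  (Star; ε; _◅_; _◅◅_; reverse)
open import Relation.Binary.Definitions using (tri<; tri≈; tri>)
open import Relation.Binary.PropositionalEquality using (_≡_; _≢_; refl; sym; trans; cong; subst)
open import Relation.Nullary using
  (¬_; yes; no; contradiction; Dec; _×-dec_; _⊎-dec_; ¬?; True; ⌊_⌋)
open import Relation.Nullary.Decidable using (toWitness; fromWitness)
open import Defs

-- Enumerations of finite sets with prescribed initial values.

↔-injective : ∀ {A B : Set} (e : A ↔ B) → Injective _≡_ _≡_ (Inverse.to e)
↔-injective e = Injection.injective (↔⇒↣ e)

bijective⇒↔ : ∀ {A B : Set} (f : A → B) → Injective _≡_ _≡_ f →
              (∀ y → ∃ λ x → f x ≡ y) → A ↔ B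
bijective⇒↔ f inj surj =
  ⤖⇒↔ (mk⤖ (inj , λ y → proj₁ (surj y) , λ { refl → proj₂ (surj y) }))

T-unique : ∀ {A : Set} (f : A → Bool) {x y : ∃ (T ∘ f)} → proj₁ x ≡ proj₁ y → x ≡ y
T-unique f {x , p} {.x , q} refl = cong (x ,_) (T-irrelevant p q)

element : ∀ {n} (p : Subset n) → Fin ∣ p ∣ → Fin n
element (true  ∷ p) zero    = zero
element (true  ∷ p) (suc i) = suc (element p i)
element (false ∷ p) i       = suc (element p i)

element-∈ : ∀ {n} (p : Subset n) i → T (lookup p (element p i))
element-∈ (true  ∷ p) zero    = _
element-∈ (true  ∷ p) (suc i) = element-∈ p i
element-∈ (false ∷ p) i       = element-∈ p i

element-injective : ∀ {n} (p : Subset n) → Injective _≡_ _≡_ (element p)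
element-injective (true  ∷ p) {zero}  {zero}  eq = refl
element-injective (true  ∷ p) {suc i} {suc j} eq = cong suc (element-injective p (suc-injective eq))
element-injective (false ∷ p) eq = element-injective p (suc-injective eq)

element-surjective : ∀ {n} (p : Subset n) x → T (lookup p x) → ∃ λ i → element p i ≡ x
element-surjective (true  ∷ p) zero    t = zero , refl
element-surjective (true  ∷ p) (suc x) t = let i , eq = element-surjective p x t in suc i , cong suc eq
element-surjective (false ∷ p) (suc x) t = let i , eq = element-surjective p x t in i , cong suc eq

abstract
  -- Turns a cardinality into an enumeration by listing the positions where `f` is true from left to
  -- right. Degrees enter the proof only in this form.
  count-↔ : ∀ {n} (f : Fin n → Bool) → Fin ∣ tabulate f ∣ ↔ ∃ (T ∘ f)
  count-↔ f = bijective⇒↔ (λ i → element (tabulate f) i , subst T (lookup∘tabulate f _) (element-∈ (tabulate f) i))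
    (element-injective (tabulate f) ∘ cong proj₁)
    λ (x , t) → let i , eq = element-surjective (tabulate f) x (subst T (sym (lookup∘tabulate f x)) t)
                in i , T-unique f eq

-- Induction on `j`: the value `f zero` is punched out of the codomain, the remaining values extend
-- to a permutation of one point fewer, and `insert` puts `zero` and `f zero` back.
extend-injection : ∀ j {k} (f : Fin j → Fin (j + k)) → Injective _≡_ _≡_ f →
                   ∃ λ (π : Permutation′ (j + k)) → ∀ i → π ⟨$⟩ʳ (i ↑ˡ k) ≡ f i
extend-injection zero f inj = ↔-id _ , λ ()
extend-injection (suc j) {k} f inj = insert zero (f zero) π , agrees
  where
  f₀≢ : ∀ i → f zero ≢ f (suc i)
  f₀≢ i eq = contradiction (inj eq) λ ()

  f′ : Fin j → Fin (j + k)
  f′ i = punchOut (f₀≢ i)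

  ih = extend-injection j f′
    (λ {x} {y} eq → suc-injective (inj (punchOut-injective (f₀≢ x) (f₀≢ y) eq)))
  π = proj₁ ih

  agrees : ∀ i → insert zero (f zero) π ⟨$⟩ʳ (i ↑ˡ k) ≡ f i
  agrees zero    = refl
  agrees (suc i) = trans (cong (punchIn (f zero)) (proj₂ ih i)) (punchIn-punchOut (f₀≢ i))

-- Allows an enumeration to begin with finitely many distinct elements of choice. The existence of
-- `k` is the pigeonhole principle.
extend-to-↔ : ∀ {A : Set} {n} → Fin n ↔ A → ∀ {j} (f : Fin j → A) → Injective _≡_ _≡_ f →
              ∃ λ k → ∃ λ (e : Fin (j + k) ↔ A) → ∀ i → Inverse.to e (i ↑ˡ k) ≡ f i
extend-to-↔ e {j} f inj
  with k , refl ← m≤n⇒∃[o]m+o≡n (injective⇒≤ (inj ∘ ↔-injective (↔-sym e)))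
  with π , agrees ← extend-injection j {k} (Inverse.from e ∘ f) (inj ∘ ↔-injective (↔-sym e))
  = k , e ↔-∘ π , λ i → Inverse.inverseˡ e (agrees i)

pair : ∀ {A : Set} → A → A → Fin 2 → A
pair x y 0F = x
pair x y 1F = y

pair-injective : ∀ {A : Set} {x y : A} → x ≢ y → Injective _≡_ _≡_ (pair x y)
pair-injective x≢y {0F} {0F} eq = refl
pair-injective x≢y {0F} {1F} eq = contradiction eq x≢y
pair-injective x≢y {1F} {0F} eq = contradiction (sym eq) x≢y
pair-injective x≢y {1F} {1F} eq = refl

triple : ∀ {A : Set} → A → A → A → Fin 3 → A
triple x y z 0F = x
triple x y z 1F = y
triple x y z 2F = z

triple-injective : ∀ {A : Set} {x y z : A} → x ≢ y → x ≢ z → y ≢ z → Injective _≡_ _≡_ (triple x y z)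
triple-injective x≢y x≢z y≢z {0F} {0F} eq = refl
triple-injective x≢y x≢z y≢z {0F} {1F} eq = contradiction eq x≢y
triple-injective x≢y x≢z y≢z {0F} {2F} eq = contradiction eq x≢z
triple-injective x≢y x≢z y≢z {1F} {0F} eq = contradiction (sym eq) x≢y
triple-injective x≢y x≢z y≢z {1F} {1F} eq = refl
triple-injective x≢y x≢z y≢z {1F} {2F} eq = contradiction eq y≢z
triple-injective x≢y x≢z y≢z {2F} {0F} eq = contradiction (sym eq) x≢z
triple-injective x≢y x≢z y≢z {2F} {1F} eq = contradiction (sym eq) y≢z
triple-injective x≢y x≢z y≢z {2F} {2F} eq = refl

-- Cyclic rotation.

prev : ∀ {k} → Fin (suc k) → Fin (suc k)
prev zero    = fromℕ _
prev (suc i) = inject₁ i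

next : ∀ {k} → Fin (suc k) → Fin (suc k)
next i with view i
... | ‵fromℕ     = zero
... | ‵inject₁ j = suc j

rotation : ∀ k → Permutation′ (suc k)
rotation k = mk↔ₛ′ prev next prev-next next-prev
  where
  prev-next : (i : Fin (suc k)) → prev (next i) ≡ i
  prev-next i with view i
  ... | ‵fromℕ     = refl
  ... | ‵inject₁ j = refl

  next-prev : (i : Fin (suc k)) → next (prev i) ≡ i
  next-prev zero    rewrite view-fromℕ k   = refl
  next-prev (suc i) rewrite view-inject₁ i = refl

prev≢ : ∀ {k} (i : Fin (2 + k)) → prev i ≢ i
prev≢ (suc i) eq = <⇒≢ (n<1+n (toℕ i)) (trans (sym (toℕ-inject₁ i)) (cong toℕ eq))

-- Length three is the least for which this holds. The two arguments where the index wraps around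
-- are refuted by a clash of constructors.
prev²≢ : ∀ {k} (i : Fin (3 + k)) → prev (prev i) ≢ i
prev²≢ (suc (suc i)) eq = <⇒≢ (m<n⇒m<1+n (n<1+n (toℕ i)))
  (trans (sym (trans (toℕ-inject₁ (inject₁ i)) (toℕ-inject₁ i))) (cong toℕ eq))

-- Degrees and neighbourhoods.

degree-↔ : ∀ {m} (G : Graph m) v → Fin (degree G v) ↔ ∃ (Adj G v)
degree-↔ G v = count-↔ (adj G v)

degree-≡ : ∀ {m} (G : Graph m) v {k} (x : Fin k → Fin m) → Injective _≡_ _≡_ x →
           (∀ i → Adj G v (x i)) → (∀ u → Adj G v u → ∃ λ i → x i ≡ u) → degree G v ≡ k
degree-≡ G v x inj sound complete′ = sym (↔⇒≡ (↔-sym (degree-↔ G v) ↔-∘ neighbours))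
  where
  neighbours = bijective⇒↔ (λ i → x i , sound i) (inj ∘ cong proj₁)
    λ { (u , t) → let i , eq = complete′ u t in i , T-unique (adj G v) eq }

Adj-sym : ∀ {m} (G : Graph m) {u v} → Adj G u v → Adj G v u
Adj-sym G {u} {v} = subst T (symmetric G u v)

Adj⇒≢ : ∀ {m} (G : Graph m) {u v} → Adj G u v → u ≢ v
Adj⇒≢ G {u} t refl = subst T (loopless G u) t

connected-from : ∀ {m} (G : Graph m) r → (∀ v → Star (Adj G) r v) → Connected G
connected-from G r walk u v = reverse (Adj-sym G) (walk u) ◅◅ walk v

-- Graphs of permutations.

FixedPointFree : ∀ {A : Set} → (A → A) → Set
FixedPointFree f = ∀ x → f x ≢ x

module PermutationGraph {m} (π : Permutation′ m) (π≢ : FixedPointFree (π ⟨$⟩ʳ_)) where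

  abstract
    graph : Graph m
    graph = record
      { adj       = λ u v → ⌊ π ⟨$⟩ʳ u ≟ v ⌋ ∨ ⌊ π ⟨$⟩ʳ v ≟ u ⌋
      ; symmetric = λ u v → ∨-comm ⌊ π ⟨$⟩ʳ u ≟ v ⌋ _
      ; loopless  = irr
      }
      where
      irr : ∀ v → ⌊ π ⟨$⟩ʳ v ≟ v ⌋ ∨ ⌊ π ⟨$⟩ʳ v ≟ v ⌋ ≡ false
      irr v with π ⟨$⟩ʳ v ≟ v
      ... | yes eq = contradiction eq (π≢ v)
      ... | no  _  = refl

    Adj⁻ : ∀ {u v} → Adj graph u v → π ⟨$⟩ʳ u ≡ v ⊎ π ⟨$⟩ʳ v ≡ u
    Adj⁻ {u} {v} t with Equivalence.to (T-∨ {⌊ π ⟨$⟩ʳ u ≟ v ⌋}) t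
    ... | inj₁ p = inj₁ (toWitness p)
    ... | inj₂ p = inj₂ (toWitness p)

    Adj⁺ : ∀ {u v} → π ⟨$⟩ʳ u ≡ v → Adj graph u v
    Adj⁺ {u} eq = Equivalence.from (T-∨ {⌊ π ⟨$⟩ʳ u ≟ _ ⌋}) (inj₁ (fromWitness eq))

  -- For an involution, the image and the preimage of a vertex coincide and form its only neighbour.
  1-regular : (∀ u → π ⟨$⟩ʳ (π ⟨$⟩ʳ u) ≡ u) → Regular 1 graph
  1-regular invol v = degree-≡ graph v (λ { 0F → π ⟨$⟩ʳ v }) (λ { {0F} {0F} _ → refl })
    (λ { 0F → Adj⁺ refl })
    λ u t → 0F , [ (λ eq → eq) , (λ { refl → invol u }) ]′ (Adj⁻ t)

  -- The neighbours of `v` are its image and its preimage. If these were equal, applying `π` would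
  -- make `v` a fixed point of the square.
  2-regular : FixedPointFree (λ u → π ⟨$⟩ʳ (π ⟨$⟩ʳ u)) → Regular 2 graph
  2-regular π²≢ v = degree-≡ graph v (pair (π ⟨$⟩ʳ v) (π ⟨$⟩ˡ v))
    (pair-injective λ eq → π²≢ v (trans (cong (π ⟨$⟩ʳ_) eq) (inverseʳ π)))
    (λ { 0F → Adj⁺ refl ; 1F → Adj-sym graph (Adj⁺ (inverseʳ π)) })
    λ u t → [ (0F ,_) , (λ { refl → 1F , inverseˡ π }) ]′ (Adj⁻ t)

-- Conjugation by `e`: a permutation of the vertices is described on an index set `A` where its
-- cycle structure is visible.
transport : ∀ {A : Set} {m} → A ↔ Fin m → A ↔ A → Permutation′ m
transport e σ = e ↔-∘ (σ ↔-∘ ↔-sym e)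

module _ {A : Set} {m} (e : A ↔ Fin m) (σ : A ↔ A) where
  open Inverse using (to; from; strictlyInverseˡ; strictlyInverseʳ)

  transport-to : ∀ x → transport e σ ⟨$⟩ʳ to e x ≡ to e (to σ x)
  transport-to x = cong (to e ∘ to σ) (strictlyInverseʳ e x)

  transport-from : ∀ x → transport e σ ⟨$⟩ˡ to e x ≡ to e (from σ x)
  transport-from x = cong (to e ∘ from σ) (strictlyInverseʳ e x)

  transport-FixedPointFree : FixedPointFree (to σ) → FixedPointFree (transport e σ ⟨$⟩ʳ_)
  transport-FixedPointFree σ≢ u eq = σ≢ (from e u) (sym (Inverse.inverseʳ e (sym eq)))

  transport-FixedPointFree² : FixedPointFree (to σ ∘ to σ) →
    FixedPointFree (λ u → transport e σ ⟨$⟩ʳ (transport e σ ⟨$⟩ʳ u))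
  transport-FixedPointFree² σ²≢ u eq = σ²≢ (from e u)
    (sym (Inverse.inverseʳ e (sym (trans (sym (transport-to (to σ (from e u)))) eq))))

  transport-involutive : (∀ x → to σ (to σ x) ≡ x) →
    ∀ u → transport e σ ⟨$⟩ʳ (transport e σ ⟨$⟩ʳ u) ≡ u
  transport-involutive invol u =
    trans (transport-to (to σ (from e u))) (Inverse.inverseˡ e (invol (from e u)))

-- A perfect matching as an involution.

module Matching {m} (M : Graph m) (regular : Regular 1 M) where

  abstract
    neighbour-↔ : ∀ u → Fin 1 ↔ ∃ (Adj M u)
    neighbour-↔ u = subst (λ d → Fin d ↔ ∃ (Adj M u)) (regular u) (degree-↔ M u)

  mate : Fin m → Fin m
  mate u = proj₁ (Inverse.to (neighbour-↔ u) 0F)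

  mate-Adj : ∀ u → Adj M u (mate u)
  mate-Adj u = proj₂ (Inverse.to (neighbour-↔ u) 0F)

  -- The neighbours of `u` are in bijection with `Fin 1`, so `v` has to be the enumerated one.
  mate-unique : ∀ {u v} → Adj M u v → mate u ≡ v
  mate-unique {u} {v} t with Inverse.from (neighbour-↔ u) (v , t) in eq
  ... | 0F = cong proj₁ (Inverse.inverseˡ (neighbour-↔ u) (sym eq))

  mate-involutive : ∀ u → mate (mate u) ≡ u
  mate-involutive u = mate-unique (Adj-sym M (mate-Adj u))

  mate-≢ : ∀ u → mate u ≢ u
  mate-≢ u eq = Adj⇒≢ M (mate-Adj u) (sym eq)

-- Permutation graphs inside the complete graph with a new vertex.

module _ {m} (S : Subset m) where

  G : Graph (suc m)
  G = addVertex (complete m) S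

  Adj-old : ∀ {u v} → u ≢ zero → v ≢ zero → u ≢ v → Adj G u v
  Adj-old {zero}          u≢0 v≢0 u≢v = contradiction refl u≢0
  Adj-old {suc u} {zero}  u≢0 v≢0 u≢v = contradiction refl v≢0
  Adj-old {suc u} {suc v} u≢0 v≢0 u≢v with u ≟ v
  ... | yes u≡v = contradiction (cong suc u≡v) u≢v
  ... | no  _   = _

  module _ (π : Permutation′ (suc m)) (π≢ : FixedPointFree (π ⟨$⟩ʳ_)) where
    open PermutationGraph π π≢

    permutationGraph-⊆ : Adj G zero (π ⟨$⟩ʳ zero) → Adj G zero (π ⟨$⟩ˡ zero) → graph ⊆ᴱ G
    permutationGraph-⊆ 0→ →0 u v t =
      [ (λ { refl → arc u }) , (λ { refl → Adj-sym G {v} (arc v) }) ]′ (Adj⁻ t)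
      where
      arc : ∀ u → Adj G u (π ⟨$⟩ʳ u)
      arc u with u ≟ zero | π ⟨$⟩ʳ u ≟ zero
      ... | yes refl | _      = 0→
      ... | no  u≢0  | no v≢0 = Adj-old u≢0 v≢0 (π≢ u ∘ sym)
      -- Here `u` is the preimage of `zero`, so the edge is the assumed one into `zero`, reversed.
      ... | no  u≢0  | yes eq = subst (Adj G u) (sym eq)
        (Adj-sym G {zero} {u} (subst (Adj G zero) (trans (cong (π ⟨$⟩ˡ_) (sym eq)) (inverseˡ π)) →0))

  degree-zero : degree G zero ≡ ∣ S ∣
  degree-zero = cong ∣_∣ (tabulate∘lookup S)

  zero-neighbours : ∀ {t} → ∣ S ∣ ≡ t → Fin t ↔ ∃ (Adj G zero)
  zero-neighbours eq = subst (λ d → Fin d ↔ ∃ (Adj G zero)) (trans degree-zero eq) (degree-↔ G zero)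

  -- Existence of a perfect matching.

  pairing⇒perfectMatching : ∀ {k} (e : (Fin (suc k) × Fin 2) ↔ Fin (suc m)) →
    Inverse.to e (0F , 0F) ≡ zero → Adj G zero (Inverse.to e (0F , 1F)) → ∃ (PerfectMatching G)
  pairing⇒perfectMatching {k} e e₀≡0 0~e₁ =
    graph , permutationGraph-⊆ π π≢ (subst (Adj G zero) (sym π0) 0~e₁) (subst (Adj G zero) (sym πˡ0) 0~e₁)
          , 1-regular (transport-involutive e σ flip-flip)
    where
    -- `e` lists the vertices in pairs and `flip` swaps the ends of each pair. Only the pair `0F`
    -- contains the new vertex.
    flip : Fin (suc k) × Fin 2 → Fin (suc k) × Fin 2
    flip (i , 0F) = i , 1F
    flip (i , 1F) = i , 0F

    flip-flip : ∀ x → flip (flip x) ≡ x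
    flip-flip (_ , 0F) = refl
    flip-flip (_ , 1F) = refl

    σ : (Fin (suc k) × Fin 2) ↔ (Fin (suc k) × Fin 2)
    σ = mk↔ₛ′ flip flip flip-flip flip-flip

    π = transport e σ
    π≢ = transport-FixedPointFree e σ λ { (_ , 0F) () ; (_ , 1F) () }
    open PermutationGraph π π≢

    π0 : π ⟨$⟩ʳ zero ≡ Inverse.to e (0F , 1F)
    π0 = trans (cong (π ⟨$⟩ʳ_) (sym e₀≡0)) (transport-to e σ (0F , 0F))

    πˡ0 : π ⟨$⟩ˡ zero ≡ Inverse.to e (0F , 1F)
    πˡ0 = trans (cong (π ⟨$⟩ˡ_) (sym e₀≡0)) (transport-from e σ (0F , 0F))

  -- The vertices are enumerated starting with `zero` and `a`, and the list is cut into consecutive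
  -- pairs, so these two are matched.
  perfectMatching : ∀ k → m ≡ suc (k * 2) → ∃ (Adj G zero) → ∃ (PerfectMatching G)
  perfectMatching k m-odd (a , 0~a)
    with k′ , e , agrees ← extend-to-↔ (↔-id (Fin (suc m))) (pair zero a) (pair-injective (Adj⇒≢ G 0~a))
    -- Counting vertices forces `k′` to be `k * 2`.
    with refl ← ℕ.suc-injective (ℕ.suc-injective (trans (↔⇒≡ e) (cong suc m-odd)))
    = pairing⇒perfectMatching (e ↔-∘ ↔-sym (*↔× {suc k} {2})) (agrees 0F)
        (subst (Adj G zero) (sym (agrees 1F)) 0~a)

  -- A Hamiltonian cycle extending a matching through a chosen edge at the new vertex.

  module HamiltonianExtension (M : Graph (suc m)) (perfect : PerfectMatching G M)
                              (b : Fin (suc m)) (0~b : Adj G zero b) (0≁b : ¬ Adj M zero b) where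
    open Matching M (proj₂ perfect)

    -- The first end of each oriented matching edge: the smaller one, except
    -- that b must come second.
    First : Fin (suc m) → Set
    First u = u ≡ mate b ⊎ (u ≢ b × u < mate u)

    first? : ∀ u → Dec (First u)
    first? u = (u ≟ mate b) ⊎-dec (¬? (u ≟ b) ×-dec (u <? mate u))

    -- Together with `First-total` this says that each matching edge has exactly one first end,
    -- which is what makes `vertex` a bijection.
    First-asym : ∀ {u} → First u → First (mate u) → ⊥
    First-asym {u} (inj₁ p) (inj₁ q) = mate-≢ u (trans q (sym p))
    First-asym (inj₁ refl) (inj₂ (q , _)) = q (mate-involutive b)
    First-asym {u} (inj₂ (p , _)) (inj₁ q) =
      p (trans (sym (mate-involutive u)) (trans (cong mate q) (mate-involutive b)))
    First-asym {u} (inj₂ (_ , p)) (inj₂ (_ , q)) =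
      <-asym p (subst (mate u <_) (mate-involutive u) q)

    First-total : ∀ u → First u ⊎ First (mate u)
    First-total u with u ≟ b | u ≟ mate b | <-cmp u (mate u)
    ... | yes refl | _      | _             = inj₂ (inj₁ refl)
    ... | no _     | yes p  | _             = inj₁ (inj₁ p)
    ... | no u≢b   | no _   | tri< u<u′ _ _ = inj₁ (inj₂ (u≢b , u<u′))
    ... | no _     | no _   | tri≈ _ eq _   = contradiction (sym eq) (mate-≢ u)
    ... | no _     | no u≢b′ | tri> _ _ u′<u = inj₂ (inj₂
      ( (λ eq → u≢b′ (trans (sym (mate-involutive u)) (cong mate eq)))
      , subst (mate u <_) (sym (mate-involutive u)) u′<u))

    -- The index `zero` is the least of all, hence the smaller end of its edge, and it differs from
    -- its neighbour `b`.
    First-zero : First zero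
    First-zero with mate zero in eq
    ... | zero  = contradiction eq (mate-≢ zero)
    ... | suc _ = inj₂ (Adj⇒≢ G 0~b , s≤s z≤n)

    -- `True` makes membership proof-irrelevant. `First` itself can hold in two ways, since `mate b`
    -- may also be the smaller end of its edge.
    Firsts : Set
    Firsts = ∃ λ u → True (first? u)

    toTrue : ∀ {u} → First u → True (first? u)
    toTrue {u} = fromWitness {a? = first? u}

    fromTrue : ∀ {u} → True (first? u) → First u
    fromTrue {u} = toWitness {a? = first? u}

    abstract
      -- Lists the oriented edge from `mate b` to `b` at index `0F` and the one starting at `zero`
      -- at index `1F`, so that `b` and `zero` become consecutive. The two are distinct edges
      -- because `M` does not join `zero` to `b`.
      enumeration : ∃ λ k → ∃ λ (r : Fin (2 + k) ↔ Firsts) → ∀ i →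
        Inverse.to r (i ↑ˡ k) ≡ pair (mate b , toTrue (inj₁ refl)) (zero , toTrue First-zero) i
      enumeration = extend-to-↔ (count-↔ (λ u → ⌊ first? u ⌋)) _ (pair-injective λ eq →
        0≁b (subst (Adj M zero) (trans (sym (cong mate (cong proj₁ eq))) (mate-involutive b)) (mate-Adj zero)))

    k = proj₁ enumeration
    r = proj₁ (proj₂ enumeration)

    first : Fin (2 + k) → Fin (suc m)
    first i = proj₁ (Inverse.to r i)

    first-First : ∀ i → First (first i)
    first-First i = fromTrue (proj₂ (Inverse.to r i))

    first-injective : Injective _≡_ _≡_ first
    first-injective eq = ↔-injective r (T-unique (λ u → ⌊ first? u ⌋) eq)

    first-surjective : ∀ {u} → First u → ∃ λ i → first i ≡ u
    first-surjective {u} p = Inverse.from r (u , toTrue p) ,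
      cong proj₁ (Inverse.strictlyInverseˡ r (u , toTrue p))

    first≢mate : ∀ {i j} → first i ≢ mate (first j)
    first≢mate {i} {j} eq = First-asym (first-First j) (subst First eq (first-First i))

    Position : Set
    Position = Fin (2 + k) × Bool

    vertex : Position → Fin (suc m)
    vertex (i , false) = first i
    vertex (i , true)  = mate (first i)

    vertex-injective : Injective _≡_ _≡_ vertex
    vertex-injective {i , false} {j , false} eq = cong (_, false) (first-injective eq)
    vertex-injective {i , false} {j , true}  eq = contradiction eq first≢mate
    vertex-injective {i , true}  {j , false} eq = contradiction (sym eq) first≢mate
    vertex-injective {i , true}  {j , true}  eq = cong (_, true) (first-injective
      (trans (sym (mate-involutive _)) (trans (cong mate eq) (mate-involutive _))))

    vertex-surjective : ∀ u → ∃ λ x → vertex x ≡ u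
    vertex-surjective u with First-total u
    ... | inj₁ p = let i , eq = first-surjective p in (i , false) , eq
    ... | inj₂ p = let i , eq = first-surjective p in
      (i , true) , trans (cong mate eq) (mate-involutive u)

    e : Position ↔ Fin (suc m)
    e = bijective⇒↔ vertex vertex-injective vertex-surjective

    -- The cycle is traversed backwards: from the second end of an edge across to its first end,
    -- then on to the second end of the previous edge.
    σ : Position ↔ Position
    σ = mk↔ₛ′ (λ { (i , true) → i , false ; (i , false) → prev i , true })
              (λ { (i , false) → i , true ; (i , true) → next i , false })
              (λ { (i , false) → refl ; (i , true) → cong (_, true) (Inverse.strictlyInverseˡ (rotation _) i) })
              (λ { (i , true) → refl ; (i , false) → cong (_, false) (Inverse.strictlyInverseʳ (rotation _) i) })

    π = transport e σ
    π≢ = transport-FixedPointFree e σ λ { (_ , false) () ; (_ , true) () }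
    open PermutationGraph π π≢

    -- Two steps lead to the same end of the previous edge, which is a different edge because there
    -- are at least two.
    π²≢ = transport-FixedPointFree² e σ
      λ { (i , false) → prev≢ i ∘ cong proj₁ ; (i , true) → prev≢ i ∘ cong proj₁ }

    vertex-step : ∀ x → Adj graph (vertex x) (vertex (Inverse.to σ x))
    vertex-step x = Adj⁺ (transport-to e σ x)

    first-0 : first 0F ≡ mate b
    first-0 = cong proj₁ (proj₂ (proj₂ enumeration) 0F)

    first-1 : first 1F ≡ zero
    first-1 = cong proj₁ (proj₂ (proj₂ enumeration) 1F)

    π0≡b : π ⟨$⟩ʳ zero ≡ b
    π0≡b = trans (cong (π ⟨$⟩ʳ_) (sym first-1)) (trans (transport-to e σ (1F , false))
      (trans (cong mate first-0) (mate-involutive b)))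

    πˡ0≡mate : π ⟨$⟩ˡ zero ≡ mate zero
    πˡ0≡mate = trans (cong (π ⟨$⟩ˡ_) (sym first-1)) (trans (transport-from e σ (1F , false))
      (cong mate first-1))

    graph-⊆ : graph ⊆ᴱ G
    graph-⊆ = permutationGraph-⊆ π π≢ (subst (Adj G zero) (sym π0≡b) 0~b)
      (subst (Adj G zero) (sym πˡ0≡mate) (proj₁ perfect zero _ (mate-Adj zero)))

    walk : ∀ i → Star (Adj graph) (vertex (0F , false)) (vertex (i , false))
    walk = <-weakInduction (λ i → Star (Adj graph) (vertex (0F , false)) (vertex (i , false))) ε
      -- Both edges are taken against the direction of `σ`: across the edge at `inject₁ i`, then on
      -- to the first end of the edge at `suc i`.
      λ i w → w ◅◅ Adj-sym graph (vertex-step (inject₁ i , true)) ◅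
                   Adj-sym graph (vertex-step (suc i , false)) ◅ ε

    connected : Connected graph
    connected = connected-from graph (vertex (0F , false)) λ v → reach (vertex-surjective v)
      where
      reach : ∀ {v} → (∃ λ x → vertex x ≡ v) → Star (Adj graph) (vertex (0F , false)) v
      reach ((i , false) , refl) = walk i
      reach ((i , true)  , refl) = walk i ◅◅ Adj-sym graph (vertex-step (i , true)) ◅ ε

    vertex-mate : ∀ x → Adj graph (vertex x) (mate (vertex x))
    vertex-mate (i , false) = Adj-sym graph (vertex-step (i , true))
    vertex-mate (i , true)  =
      subst (Adj graph (mate (first i))) (sym (mate-involutive (first i))) (vertex-step (i , true))

    mate-Adj-graph : ∀ u → Adj graph u (mate u)
    mate-Adj-graph u = let x , eq = vertex-surjective u in
      subst (λ u → Adj graph u (mate u)) eq (vertex-mate x)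

    extends : Extends G graph M
    extends = ((graph-⊆ , 2-regular π²≢) , connected) ,
      λ u v t → subst (Adj graph u) (mate-unique t) (mate-Adj-graph u)

    uses : Adj graph zero b
    uses = Adj⁺ π0≡b

  hamiltonianExtension : ∀ M → PerfectMatching G M → ∀ b → Adj G zero b → ¬ Adj M zero b →
                         ∃ λ H → Extends G H M × Adj H zero b
  hamiltonianExtension M perfect b 0~b 0≁b = PermutationGraph.graph π π≢ , extends , uses
    where open HamiltonianExtension M perfect b 0~b 0≁b

  -- Malleability of the new vertex and the PMH property.

  malleable : ∃ (PerfectMatching G) → ∀ t → 2 ≤ t → ∣ S ∣ ≡ t → Malleable G t zero
  malleable matching (suc t) 2≤t ∣S∣≡t = matching , trans degree-zero ∣S∣≡t , 2≤t , λ M perfect →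
    let open Matching M (proj₂ perfect)
        s  = zero-neighbours ∣S∣≡t
        a  = mate zero , proj₁ perfect zero _ (mate-Adj zero)
        i₀ = Inverse.from s a

        other : Fin t → ∃ (Adj G zero)
        -- `punchIn i₀` skips the index of the mate of `zero`, leaving exactly `t` of the `suc t`
        -- neighbours. Each of them gets its own Hamiltonian cycle.
        other i = Inverse.to s (punchIn i₀ i)

        unmatched : ∀ i → ¬ Adj M zero (proj₁ (other i))
        unmatched i q = punchInᵢ≢i i₀ i
          (sym (Inverse.inverseʳ s (T-unique (adj G zero) {a} {other i} (mate-unique q))))

        ext : ∀ i → _
        ext i = hamiltonianExtension M perfect (proj₁ (other i)) (proj₂ (other i)) (unmatched i)
    in (λ i → proj₁ (ext i)) , (λ i → proj₁ (proj₂ (ext i))) , λ u 0~u 0≁u →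
      let j = Inverse.from s (u , 0~u)

          i₀≢j : i₀ ≢ j
          i₀≢j eq = 0≁u (subst (Adj M zero) (cong proj₁ (↔-injective (↔-sym s) eq)) (mate-Adj zero))

          i = punchOut i₀≢j

          other-i : proj₁ (other i) ≡ u
          other-i = cong proj₁ (Inverse.inverseˡ s (punchIn-punchOut i₀≢j))
      in i , subst (Adj (proj₁ (ext i)) zero) other-i (proj₂ (proj₂ (ext i)))

  -- Since `t` is at least 2, malleability supplies at least one Hamiltonian cycle for every perfect
  -- matching.
  malleable⇒PMH : ∀ t → Malleable G t zero → PMH G
  malleable⇒PMH (suc (suc t)) (matching , _ , _ , H) = matching , λ M perfect →
    let Hs , ext , _ = H M perfect in Hs 0F , ext 0F
  malleable⇒PMH zero (_ , _ , () , _)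
  malleable⇒PMH (suc zero) (_ , _ , s≤s () , _)

  -- A disconnected 2-factor.

  twoCycles⇒¬2FH : ∀ {k} (e : (Fin 3 ⊎ Fin (3 + k)) ↔ Fin (suc m)) → Inverse.to e (inj₁ 0F) ≡ zero →
    Adj G zero (Inverse.to e (inj₁ 1F)) → Adj G zero (Inverse.to e (inj₁ 2F)) → ¬ 2FH G
  twoCycles⇒¬2FH {k} e e₀≡0 0~e₁ 0~e₂ (_ , hamiltonian) =
    -- If this 2-factor were connected, a walk would lead from the triangle to the other cycle, but
    -- every edge at a triangle vertex stays in the triangle.
    contradiction (stays (proj₂ (hamiltonian graph (graph-⊆ , 2-regular π²≢)) _ _) start) escapes
    where
    σ : (Fin 3 ⊎ Fin (3 + k)) ↔ (Fin 3 ⊎ Fin (3 + k))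
    -- `rotation k` acts on `suc k` points, so both cycles have length at least 3, as `prev²≢`
    -- requires.
    σ = rotation 2 ⊎-↔ rotation (2 + k)

    π = transport e σ
    π≢ = transport-FixedPointFree e σ
      λ { (inj₁ i) → prev≢ i ∘ inj₁-injective ; (inj₂ i) → prev≢ i ∘ inj₂-injective }
    π²≢ = transport-FixedPointFree² e σ
      λ { (inj₁ i) → prev²≢ i ∘ inj₁-injective ; (inj₂ i) → prev²≢ i ∘ inj₂-injective }
    open PermutationGraph π π≢

    π0 : π ⟨$⟩ʳ zero ≡ Inverse.to e (inj₁ 2F)
    π0 = trans (cong (π ⟨$⟩ʳ_) (sym e₀≡0)) (transport-to e σ (inj₁ 0F))

    πˡ0 : π ⟨$⟩ˡ zero ≡ Inverse.to e (inj₁ 1F)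
    πˡ0 = trans (cong (π ⟨$⟩ˡ_) (sym e₀≡0)) (transport-from e σ (inj₁ 0F))

    graph-⊆ : graph ⊆ᴱ G
    graph-⊆ = permutationGraph-⊆ π π≢ (subst (Adj G zero) (sym π0) 0~e₂)
                                      (subst (Adj G zero) (sym πˡ0) 0~e₁)

    InTriangle : Fin (suc m) → Set
    InTriangle u = ∃ λ i → Inverse.to e (inj₁ i) ≡ u

    step : ∀ {u v} → Adj graph u v → InTriangle u → InTriangle v
    step t (i , refl) = [ (λ { refl → prev i , sym (transport-to e σ (inj₁ i)) })
                        , (λ eq → next i , trans (sym (transport-from e σ (inj₁ i)))
                            (trans (cong (π ⟨$⟩ˡ_) (sym eq)) (inverseˡ π))) ]′ (Adj⁻ t)

    stays : ∀ {u v} → Star (Adj graph) u v → InTriangle u → InTriangle v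
    stays ε       p = p
    stays (t ◅ w) p = stays w (step t p)

    start : InTriangle (Inverse.to e (inj₁ 0F))
    start = 0F , refl

    escapes : ¬ InTriangle (Inverse.to e (inj₂ 0F))
    escapes (i , eq) = contradiction (↔-injective e eq) λ ()

  ¬2FH : 5 ≤ m → ∀ {a b} → Adj G zero a → Adj G zero b → a ≢ b → ¬ 2FH G
  ¬2FH 5≤m {a} {b} 0~a 0~b a≢b
    with k , 5+k≡m ← m≤n⇒∃[o]m+o≡n 5≤m
    with k′ , e , agrees ← extend-to-↔ (↔-id (Fin (suc m))) (triple zero a b)
                             (triple-injective (Adj⇒≢ G 0~a) (Adj⇒≢ G 0~b) a≢b)
    -- There are `6 + k` vertices in all, so `3 + k` remain outside the triangle, enough for a
    -- second cycle.
    with refl ← ℕ.+-cancelˡ-≡ 3 _ _ (trans (↔⇒≡ e) (cong suc (sym 5+k≡m)))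
    = twoCycles⇒¬2FH (e ↔-∘ ↔-sym (+↔⊎ {3} {3 + k})) (agrees 0F)
        (subst (Adj G zero) (sym (agrees 1F)) 0~a) (subst (Adj G zero) (sym (agrees 2F)) 0~b)

proposition2p6 : (n : ℕ) → 2 ≤ n →
    (S : Subset (1 + 2 * n)) → ∣ S ∣ ≡ 3 →
    (PMH (𝒴 n S) × ¬ 2FH (𝒴 n S)) × Malleable (𝒴 n S) 3 zero
proposition2p6 n 2≤n S ∣S∣≡3 = (malleable⇒PMH S 3 mal , not2FH) , mal
  where
  s = zero-neighbours S ∣S∣≡3

  mal = malleable S (perfectMatching S n (cong suc (*-comm 2 n)) (Inverse.to s 0F)) 3 (s≤s (s≤s z≤n)) ∣S∣≡3

  not2FH = ¬2FH S (s≤s (*-monoʳ-≤ 2 2≤n)) (proj₂ (Inverse.to s 0F)) (proj₂ (Inverse.to s 1F))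
    λ eq → contradiction (↔-injective s (T-unique (adj (𝒴 n S) zero) eq)) λ ()
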